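{- Let $n$ be a prime and $c\in\mathbb{F}_n\setminus\{0,1,-1,-2\}$. Let $X=X_{2,n,c}$ be the $2$-dimensional simplicial complex on vertex set $\mathbb{F}_n$ containing all vertices and all edges (pairs), whose $2$-faces are the $3$-element sets $\{x_0,x_1,x_2\}\subseteq\mathbb{F}_n$ whose elements can be labeled so that $x_0+x_1+c x_2\equiv 0\pmod n$. Then $X$ is not $\mathbb{Q}$-acyclic (i.e., $H_2(X;\mathbb{Q})\neq 0$, so $X$ is not a hypertree) in each of the following cases: (i) $n\equiv 1\pmod 4$ and $c$ is not a primitive element (generator of $\mathbb{F}_n^*$); (ii) $n\equiv 3\pmod 4$ and $c$ is neither a primitive element nor of multiplicative order $\frac{n-1}{2}$. -}

module Defs where

open import Data.Nat using (ℕ; zero; suc; _+_; _*_; _∸_; _^_; _≤_; _<_)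
open import Data.Integer using (ℤ; +_) renaming (_-_ to _-ℤ_)
open import Data.Integer.Divisibility using (_∣_)
open import Data.Fin using (Fin; toℕ)
import Data.Fin as F
open import Data.List using (List; foldr; allFin)
open import Data.Rational using (ℚ; 0ℚ) renaming (_+_ to _+ℚ_; _-_ to _-ℚ_)
open import Data.Product using (Σ; ∃; _×_)
open import Data.Sum using (_⊎_)
open import Relation.Binary.PropositionalEquality using (_≡_; _≢_)
open import Relation.Nullary using (¬_)

-- Vertices of X_{2,n,c} are the elements of F_n, represented as Fin n;
-- field arithmetic is arithmetic of representatives modulo n.

infix 4 _≡_[mod_]
_≡_[mod_] : ℕ → ℕ → ℕ → Set
a ≡ b [mod n ] = (+ n) ∣ ((+ a) -ℤ (+ b))

Lin : (n : ℕ) → Fin n → Fin n → Fin n → Fin n → Set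
Lin n c x0 x1 x2 = toℕ x0 + toℕ x1 + toℕ c * toℕ x2 ≡ 0 [mod n ]

-- {a,b,d} with a < b < d is a 2-face of X_{2,n,c}: its elements can be
-- labelled x0,x1,x2 with x0 + x1 + c x2 ≡ 0.  Since the equation is
-- symmetric in x0,x1, it suffices to choose which element is x2.
IsTwoFace : (n : ℕ) → Fin n → Fin n → Fin n → Fin n → Set
IsTwoFace n c a b d =
  a F.< b × b F.< d × (Lin n c a b d ⊎ Lin n c a d b ⊎ Lin n c b d a)

-- Rational 2-chains: coefficient z a b d of the oriented face [a,b,d]
-- (only increasing triples that are 2-faces may carry nonzero coefficient).
Chain2 : ℕ → Set
Chain2 n = Fin n → Fin n → Fin n → ℚ

IsChainOf : (n : ℕ) → Fin n → Chain2 n → Set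
IsChainOf n c z = ∀ a b d → z a b d ≢ 0ℚ → IsTwoFace n c a b d

sumFin : (n : ℕ) → (Fin n → ℚ) → ℚ
sumFin n f = foldr (λ i acc → f i +ℚ acc) 0ℚ (allFin n)

-- Coefficient of the edge [u,v] (u < v) in ∂z, where
-- ∂[a,b,d] = [b,d] - [a,d] + [a,b].
boundary : (n : ℕ) → Chain2 n → Fin n → Fin n → ℚ
boundary n z u v =
  (sumFin n (λ w → z u v w) -ℚ sumFin n (λ w → z u w v)) +ℚ sumFin n (λ w → z w u v)

-- H_2(X;ℚ) ≠ 0.  X is 2-dimensional, so H_2(X;ℚ) = ker ∂₂ (2-cycles);
-- it is nonzero iff there is a nonzero rational 2-cycle.
H2Nonzero : (n : ℕ) → Fin n → Set
H2Nonzero n c = Σ (Chain2 n) λ z →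
  IsChainOf n c z
  × (∀ u v → u F.< v → boundary n z u v ≡ 0ℚ)
  × ∃ λ a → ∃ λ b → ∃ λ d → z a b d ≢ 0ℚ

IsPrimitive : (n : ℕ) → Fin n → Set
IsPrimitive n c = ∀ (y : Fin n) → toℕ y ≢ 0 → ∃ λ k → toℕ c ^ k ≡ toℕ y [mod n ]

HasOrder : (n : ℕ) → Fin n → ℕ → Set
HasOrder n c k =
  1 ≤ k × toℕ c ^ k ≡ 1 [mod n ]
  × (∀ j → 1 ≤ j → j < k → ¬ (toℕ c ^ j ≡ 1 [mod n ]))

{-# OPTIONS --safe #-}
-- Let S be the subgroup of 𝔽ₙ* generated by c and −1. In each of the two cases S is proper: if it
-- were all of 𝔽ₙ* and c were not primitive, then −1 ∉ ⟨c⟩, so c would have order (n − 1)/2, and this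
-- order would be odd since otherwise a power of c is a square root of 1 other than 1, that is, −1.
-- The link of the vertex 0 has the edges {y , −y} and {y , −cy}, so S is a union of components of it
-- and the link is disconnected. The coboundary of the indicator of S, corrected to 0 on the edges at
-- 0, is therefore a cocycle; it is not a coboundary, so H¹ ≠ 0.
-- There are as many 2-faces as edges off 0, namely (n − 1)(n − 2)/2, and the boundary equations of
-- the edges at 0 follow from those of the others by ∂∂ = 0. The cocycle gives one more linear
-- relation between the boundary equations, so they have a nonzero solution.
module Submission where

open import Defs
open import Data.Nat
  using (ℕ; zero; suc; _+_; _*_; _∸_; _^_; _/_; _%_; _≤_; _<_; _⊔_; s≤s; z≤n; NonZero; >-nonZero)
import Data.Nat.Properties as ℕ
open import Data.Nat.Tactic.RingSolver renaming (solve-∀ to solveℕ-∀)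
open import Data.Nat.Divisibility using (∣⇒≤)
  renaming (_∣_ to _∣ℕ_; divides to divides-ℕ)
open import Data.Nat.DivMod using (m≡m%n+[m/n]*n; m%n<n; m*n/n≡m)
open import Data.Nat.Induction using (<-rec)
open import Data.Nat.Primality using (Prime; euclidsLemma; ¬prime[1])
open import Data.Integer using (ℤ; +_; ∣_∣)
  renaming (_+_ to _+ℤ_; _*_ to _*ℤ_; -_ to -ℤ_; _-_ to _-ℤ_)
import Data.Integer.Properties as ℤ
open import Data.Integer.Tactic.RingSolver renaming (solve-∀ to solveℤ-∀)
open import Data.Integer.DivMod using (_%ℕ_; _/ℕ_; n%ℕd<d; a≡a%ℕn+[a/ℕn]*n)
open import Data.Integer.Divisibility.Signed
  using (_∣_; divides; ∣ᵤ⇒∣; ∣⇒∣ᵤ; _∣?_; ∣m∣n⇒∣m+n; ∣n⇒∣m*n)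
open import Data.Fin
  using (Fin; zero; suc; toℕ; fromℕ<; splitAt; join; punchIn; punchOut; remQuot; combine)
import Data.Fin as F
open import Data.Fin.Properties
  using (any?; _<?_; toℕ<n; toℕ-fromℕ<; toℕ-injective; pigeonhole; injective⇒≤; join-splitAt;
         splitAt-join; remQuot-combine; combine-remQuot; combine-injective; punchIn-punchOut;
         punchInᵢ≢i; <-cmp; <-asym; <-trans)
  renaming (_≟_ to _≟F_)
open import Data.List using (foldr; tabulate)
open import Data.Rational using (ℚ; 0ℚ; 1ℚ; 1/_; ≢-nonZero)
  renaming (_+_ to _+ℚ_; _*_ to _*ℚ_; -_ to -ℚ_; _-_ to _-ℚ_)
import Data.Rational.Properties as ℚ
open import Data.Product using (∃; _×_; _,_; proj₁; proj₂; uncurry)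
open import Data.Sum using (_⊎_; inj₁; inj₂)
import Data.Sum as Sum
open import Data.Vec.Functional using (_∷_; removeAt)
open import Function using (_∘_; id)
open import Level using (0ℓ)
open import Relation.Binary.Definitions using (tri<; tri≈; tri>)
open import Relation.Binary.PropositionalEquality
  using (_≡_; _≢_; refl; sym; trans; cong; cong₂; subst; module ≡-Reasoning)
open import Relation.Nullary using (¬_; Dec; yes; no; contradiction)
open import Relation.Nullary.Decidable
  using (¬?; decidable-stable; dec⇒maybe; map′; _⊎-dec_; _×-dec_)
open import Algebra.Bundles using (CommutativeRing)
open import Algebra.Properties.CommutativeMonoid.Sum ℚ.+-0-commutativeMonoid
  using (sum; sum-cong-≗; sum-replicate-zero; sum-remove; ∑-comm)
import Algebra.Properties.Semiring.Sum as SemiringSum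
open import Tactic.RingSolver using (solve-∀)
open import Tactic.RingSolver.Core.AlmostCommutativeRing
  using (AlmostCommutativeRing; fromCommutativeRing)

-- Linear algebra over ℚ

open SemiringSum (CommutativeRing.semiring ℚ.+-*-commutativeRing) using (*-distribˡ-sum)

ℚ-ring : AlmostCommutativeRing 0ℓ 0ℓ
ℚ-ring = fromCommutativeRing ℚ.+-*-commutativeRing λ p → dec⇒maybe (0ℚ ℚ.≟ p)

*≢0 : ∀ {p q} → p ≢ 0ℚ → q ≢ 0ℚ → p *ℚ q ≢ 0ℚ
*≢0 {p} {q} p≢0 q≢0 pq≡0 = q≢0 (begin
  q                     ≡⟨ ℚ.*-identityˡ q ⟨
  1ℚ *ℚ q               ≡⟨ cong (_*ℚ q) (ℚ.*-inverseˡ p) ⟨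
  (1/ p) *ℚ p *ℚ q      ≡⟨ ℚ.*-assoc (1/ p) p q ⟩
  (1/ p) *ℚ (p *ℚ q)    ≡⟨ cong ((1/ p) *ℚ_) pq≡0 ⟩
  (1/ p) *ℚ 0ℚ          ≡⟨ ℚ.*-zeroʳ (1/ p) ⟩
  0ℚ                    ∎)
  where
  open ≡-Reasoning
  instance _ = ≢-nonZero p≢0

-- The combination is a separate `w` that agrees with it pointwise, so the field also says that `L`
-- respects pointwise equality, and functions never have to be identified.
record Linear {I : Set} (L : (I → ℚ) → ℚ) : Set where
  field
    preserves : ∀ a b x y w → (∀ i → w i ≡ a *ℚ x i +ℚ b *ℚ y i) →
                L w ≡ a *ℚ L x +ℚ b *ℚ L y

open Linear

private
  variable
    I J : Set

linear-zero : Linear {I} (λ _ → 0ℚ)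
linear-zero .preserves a b _ _ _ _ = zeros a b
  where
  zeros : ∀ a b → 0ℚ ≡ a *ℚ 0ℚ +ℚ b *ℚ 0ℚ
  zeros = solve-∀ ℚ-ring

linear-eval : (i : I) → Linear (λ w → w i)
linear-eval i .preserves _ _ _ _ _ eq = eq i

linear-+ : ∀ {L M : (I → ℚ) → ℚ} → Linear L → Linear M → Linear (λ w → L w +ℚ M w)
linear-+ {L = L} {M} l m .preserves a b x y w eq =
  trans (cong₂ _+ℚ_ (preserves l a b x y w eq) (preserves m a b x y w eq))
        (interchange a b (L x) (L y) (M x) (M y))
  where
  interchange : ∀ a b p q r s → (a *ℚ p +ℚ b *ℚ q) +ℚ (a *ℚ r +ℚ b *ℚ s)
                              ≡ a *ℚ (p +ℚ r) +ℚ b *ℚ (q +ℚ s)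
  interchange = solve-∀ ℚ-ring

linear-* : ∀ {L : (I → ℚ) → ℚ} k → Linear L → Linear (λ w → k *ℚ L w)
linear-* {L = L} k l .preserves a b x y w eq =
  trans (cong (k *ℚ_) (preserves l a b x y w eq)) (shuffle k a b (L x) (L y))
  where
  shuffle : ∀ k a b p q → k *ℚ (a *ℚ p +ℚ b *ℚ q) ≡ a *ℚ (k *ℚ p) +ℚ b *ℚ (k *ℚ q)
  shuffle = solve-∀ ℚ-ring

linear-- : ∀ {L M : (I → ℚ) → ℚ} → Linear L → Linear M → Linear (λ w → L w -ℚ M w)
linear-- {L = L} {M} l m .preserves a b x y w eq =
  trans (cong₂ _-ℚ_ (preserves l a b x y w eq) (preserves m a b x y w eq))
        (interchange a b (L x) (L y) (M x) (M y))
  where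
  interchange : ∀ a b p q r s → (a *ℚ p +ℚ b *ℚ q) -ℚ (a *ℚ r +ℚ b *ℚ s)
                              ≡ a *ℚ (p -ℚ r) +ℚ b *ℚ (q -ℚ s)
  interchange = solve-∀ ℚ-ring

linear-∘ : ∀ {L : (J → ℚ) → ℚ} (g : J → I) → Linear L → Linear (λ w → L (w ∘ g))
linear-∘ g l .preserves a b x y w eq = preserves l a b (x ∘ g) (y ∘ g) (w ∘ g) (eq ∘ g)

linear-extend : ∀ {m} {L : (Fin (suc m) → ℚ) → ℚ} → Linear L → Linear (λ w → L (0ℚ ∷ w))
linear-extend l .preserves a b x y w eq =
  preserves l a b (0ℚ ∷ x) (0ℚ ∷ y) (0ℚ ∷ w) λ where
    -- The heads are all 0, and the required `0ℚ ≡ a *ℚ 0ℚ +ℚ b *ℚ 0ℚ` is linearity of the zero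
    -- functional; `Fin 0` makes its arguments trivial.
    zero    → preserves (linear-zero {Fin 0}) a b (λ ()) (λ ()) (λ ()) λ ()
    (suc i) → eq i

sumFin≡sum : ∀ n (f : Fin n → ℚ) → sumFin n f ≡ sum f
sumFin≡sum n f = go n id
  where
  -- The tail of `allFin` is a tabulation but not again an `allFin`, so the induction needs a
  -- general `g`.
  go : ∀ m (g : Fin m → Fin n) → foldr (λ i acc → f i +ℚ acc) 0ℚ (tabulate g) ≡ sum (f ∘ g)
  go zero    g = refl
  go (suc m) g = cong (f (g zero) +ℚ_) (go m (g ∘ suc))

linear-sum : ∀ n {L : Fin n → (I → ℚ) → ℚ} → (∀ k → Linear (L k)) → Linear (λ w → sum (λ k → L k w))
linear-sum zero    l = linear-zero
linear-sum (suc n) l = linear-+ (l zero) (linear-sum n (l ∘ suc))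

linear-sumFin : ∀ n {L : Fin n → (I → ℚ) → ℚ} → (∀ k → Linear (L k)) →
                Linear (λ w → sumFin n (λ k → L k w))
linear-sumFin n {L} l .preserves a b x y w eq
  rewrite sumFin≡sum n (λ k → L k x) | sumFin≡sum n (λ k → L k y) | sumFin≡sum n (λ k → L k w)
  = preserves (linear-sum n l) a b x y w eq

-- Gaussian elimination of the first unknown, without division: the functional
-- of index i is the pivot, and c k = L k (e₀).
kernel : ∀ m (L : Fin m → (Fin (suc m) → ℚ) → ℚ) → (∀ i → Linear (L i)) →
         ∃ λ x → (∀ i → L i x ≡ 0ℚ) × ∃ λ j → x j ≢ 0ℚ
kernel zero    L l = (λ _ → 1ℚ) , (λ ()) , zero , λ ()
kernel (suc m) L l = pivot (any? λ i → ¬? (c i ℚ.≟ 0ℚ))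
  where
  e₀ : Fin (suc (suc m)) → ℚ
  e₀ = 1ℚ ∷ λ _ → 0ℚ

  c : Fin (suc m) → ℚ
  c i = L i e₀

  pivot : Dec (∃ λ i → c i ≢ 0ℚ) → ∃ λ x → (∀ i → L i x ≡ 0ℚ) × ∃ λ j → x j ≢ 0ℚ
  pivot (no all0) = e₀ , (λ i → decidable-stable (c i ℚ.≟ 0ℚ) λ ci≢0 → all0 (i , ci≢0)) , zero , λ ()
  pivot (yes (i , ci≢0)) with kernel m
    -- This combination of rows vanishes on `e₀`, so only the remaining unknowns matter for it.
    (λ k y → c i *ℚ L (punchIn i k) (0ℚ ∷ y) -ℚ c (punchIn i k) *ℚ L i (0ℚ ∷ y))
    (λ k → linear-- (linear-* (c i) (linear-extend (l (punchIn i k))))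
                    (linear-* (c (punchIn i k)) (linear-extend (l i))))
  ... | y , Ly≡0 , j , yj≢0 = x , Lx≡0 , suc j , *≢0 ci≢0 yj≢0
    where
    p : ℚ
    p = L i (0ℚ ∷ y)

    x : Fin (suc (suc m)) → ℚ
    -- The first entry is chosen to satisfy the pivot equation: `L i x` is `-p` times `c i` plus
    -- `c i` times `p`.
    x = (-ℚ p) ∷ λ j → c i *ℚ y j

    head : ∀ a b → a ≡ a *ℚ 1ℚ +ℚ b *ℚ 0ℚ
    head = solve-∀ ℚ-ring
    tail : ∀ a b → b ≡ a *ℚ 0ℚ +ℚ b
    tail = solve-∀ ℚ-ring

    Lx : ∀ k → L k x ≡ (-ℚ p) *ℚ c k +ℚ c i *ℚ L k (0ℚ ∷ y)
    Lx k = preserves (l k) (-ℚ p) (c i) e₀ (0ℚ ∷ y) x λ where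
      zero    → head (-ℚ p) (c i)
      (suc j) → tail (-ℚ p) (c i *ℚ y j)

    Lx≡0 : ∀ k → L k x ≡ 0ℚ
    Lx≡0 k with i ≟F k
    ... | yes refl = trans (Lx i) (cancel p (c i))
      where
      cancel : ∀ a b → (-ℚ a) *ℚ b +ℚ b *ℚ a ≡ 0ℚ
      cancel = solve-∀ ℚ-ring
    ... | no i≢k = trans (Lx k) (trans (rearr p (c k) (c i) (L k (0ℚ ∷ y)))
            (subst (λ k → c i *ℚ L k (0ℚ ∷ y) -ℚ c k *ℚ p ≡ 0ℚ) (punchIn-punchOut i≢k)
                   (Ly≡0 (punchOut i≢k))))
      where
      rearr : ∀ a b c d → (-ℚ a) *ℚ b +ℚ c *ℚ d ≡ c *ℚ d -ℚ b *ℚ a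
      rearr = solve-∀ ℚ-ring

-- Finite sums and the adjunction between boundary and coboundary

sum-zero : ∀ {n} (t : Fin n → ℚ) → (∀ i → t i ≡ 0ℚ) → sum t ≡ 0ℚ
sum-zero {n} t t≡0 = trans (sum-cong-≗ t≡0) (sum-replicate-zero n)

sum-single : ∀ {n} (t : Fin n → ℚ) j → (∀ i → i ≢ j → t i ≡ 0ℚ) → sum t ≡ t j
sum-single {suc n} t j t≡0 = begin
  sum t                         ≡⟨ sum-remove {i = j} t ⟩
  t j +ℚ sum (removeAt t j)     ≡⟨ cong (t j +ℚ_) (sum-zero _ λ i → t≡0 _ (punchInᵢ≢i j i)) ⟩
  t j +ℚ 0ℚ                     ≡⟨ ℚ.+-identityʳ (t j) ⟩
  t j                           ∎
  where open ≡-Reasoning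

sum-alternating : ∀ {n} (x y z : Fin n → ℚ) →
                  sum (λ i → x i -ℚ y i +ℚ z i) ≡ sum x -ℚ sum y +ℚ sum z
sum-alternating {zero}  x y z = refl
sum-alternating {suc n} x y z =
  trans (cong (x zero -ℚ y zero +ℚ z zero +ℚ_) (sum-alternating (x ∘ suc) (y ∘ suc) (z ∘ suc)))
        (interchange (x zero) (y zero) (z zero) _ _ _)
  where
  interchange : ∀ a b c p q r → (a -ℚ b +ℚ c) +ℚ (p -ℚ q +ℚ r) ≡ (a +ℚ p) -ℚ (b +ℚ q) +ℚ (c +ℚ r)
  interchange = solve-∀ ℚ-ring

sum²-alternating : ∀ {m n} (x y z : Fin m → Fin n → ℚ) →
  sum (λ i → sum λ j → x i j -ℚ y i j +ℚ z i j)
    ≡ sum (λ i → sum (x i)) -ℚ sum (λ i → sum (y i)) +ℚ sum (λ i → sum (z i))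
sum²-alternating x y z =
  trans (sum-cong-≗ λ i → sum-alternating (x i) (y i) (z i)) (sum-alternating (sum ∘ x) (sum ∘ y) (sum ∘ z))

Cochain : ℕ → Set
Cochain n = Fin n → Fin n → ℚ

coboundary : ∀ {n} → Cochain n → Chain2 n
coboundary f a b d = f a b -ℚ f a d +ℚ f b d

-- Both sides pair each coefficient of `z` with the values of `f` on the three edges of its triple;
-- the terms are matched by exchanging sums. The sums run over all pairs and triples, sorted or not.
boundary-adjoint : ∀ n (f : Cochain n) (z : Chain2 n) →
  sum (λ u → sum λ v → f u v *ℚ boundary n z u v)
    ≡ sum (λ a → sum λ b → sum λ d → coboundary f a b d *ℚ z a b d)
boundary-adjoint n f z = begin
  sum (λ u → sum λ v → f u v *ℚ boundary n z u v)
    ≡⟨ sum-cong-≗ (λ u → sum-cong-≗ λ v → expand u v) ⟩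
  sum (λ u → sum λ v → P u v -ℚ Q u v +ℚ R u v)
    ≡⟨ sum²-alternating P Q R ⟩
  ΣΣ P -ℚ ΣΣ Q +ℚ ΣΣ R
    ≡⟨ cong₂ (λ q r → ΣΣ P -ℚ q +ℚ r) Q≡Q′ R≡R′ ⟩
  ΣΣ P -ℚ ΣΣ Q′ +ℚ ΣΣ R′
    ≡⟨ sum²-alternating P Q′ R′ ⟨
  sum (λ a → sum λ b → P a b -ℚ Q′ a b +ℚ R′ a b)
    ≡⟨ sum-cong-≗ (λ a → sum-cong-≗ λ b → collect a b) ⟨
  sum (λ a → sum λ b → sum λ d → coboundary f a b d *ℚ z a b d) ∎
  where
  open ≡-Reasoning
  ΣΣ : Cochain n → ℚ
  ΣΣ g = sum λ i → sum (g i)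

  P Q Q′ R R′ : Cochain n
  P  a b = sum λ d → f a b *ℚ z a b d
  Q  u v = sum λ w → f u v *ℚ z u w v
  Q′ a b = sum λ d → f a d *ℚ z a b d
  R  u v = sum λ w → f u v *ℚ z w u v
  R′ a b = sum λ d → f b d *ℚ z a b d

  Q≡Q′ : ΣΣ Q ≡ ΣΣ Q′
  Q≡Q′ = sum-cong-≗ λ u → ∑-comm λ v w → f u v *ℚ z u w v

  R≡R′ : ΣΣ R ≡ ΣΣ R′
  -- Here `w` has to move past both `v` and `u`, hence two exchanges.
  R≡R′ = trans (sum-cong-≗ λ u → ∑-comm λ v w → f u v *ℚ z w u v)
               (∑-comm λ u w → sum λ v → f u v *ℚ z w u v)

  expand : ∀ u v → f u v *ℚ boundary n z u v ≡ P u v -ℚ Q u v +ℚ R u v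
  expand u v
    rewrite sumFin≡sum n (λ w → z u v w) | sumFin≡sum n (λ w → z u w v) | sumFin≡sum n (λ w → z w u v)
    = trans (distrib (f u v) _ _ _)
      (cong₂ _+ℚ_ (cong₂ _-ℚ_ (*-distribˡ-sum (f u v) (λ w → z u v w)) (*-distribˡ-sum (f u v) (λ w → z u w v)))
                  (*-distribˡ-sum (f u v) (λ w → z w u v)))
    where
    distrib : ∀ a p q r → a *ℚ (p -ℚ q +ℚ r) ≡ a *ℚ p -ℚ a *ℚ q +ℚ a *ℚ r
    distrib = solve-∀ ℚ-ring

  collect : ∀ a b → sum (λ d → coboundary f a b d *ℚ z a b d) ≡ P a b -ℚ Q′ a b +ℚ R′ a b
  collect a b =
    trans (sum-cong-≗ λ d → distrib (f a b) (f a d) (f b d) (z a b d))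
          (sum-alternating (λ d → f a b *ℚ z a b d) (λ d → f a d *ℚ z a b d) (λ d → f b d *ℚ z a b d))
    where
    distrib : ∀ p q r x → (p -ℚ q +ℚ r) *ℚ x ≡ p *ℚ x -ℚ q *ℚ x +ℚ r *ℚ x
    distrib = solve-∀ ℚ-ring

-- A cocycle f annihilates ∂z, so one coefficient of ∂z follows from the others.
boundary-redundant : ∀ n (f : Cochain n) (z : Chain2 n) →
  (∀ a b d → z a b d ≢ 0ℚ → coboundary f a b d ≡ 0ℚ) →
  ∀ u₀ v₀ → f u₀ v₀ ≢ 0ℚ →
  (∀ u v → ¬ (u ≡ u₀ × v ≡ v₀) → f u v ≡ 0ℚ ⊎ boundary n z u v ≡ 0ℚ) →
  boundary n z u₀ v₀ ≡ 0ℚ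
boundary-redundant n f z cocycle u₀ v₀ f≢0 others =
  decidable-stable (_ ℚ.≟ 0ℚ) λ ∂≢0 → *≢0 f≢0 ∂≢0 (begin
    t u₀ v₀
      ≡⟨ sum-single (t u₀) v₀ (λ v v≢v₀ → t≡0 u₀ v λ (_ , v≡v₀) → v≢v₀ v≡v₀) ⟨
    sum (t u₀)
      ≡⟨ sum-single (sum ∘ t) u₀ (λ u u≢u₀ → sum-zero (t u) λ v → t≡0 u v λ (u≡u₀ , _) → u≢u₀ u≡u₀) ⟨
    sum (sum ∘ t)
      ≡⟨ boundary-adjoint n f z ⟩
    sum (λ a → sum λ b → sum λ d → coboundary f a b d *ℚ z a b d)
      ≡⟨ sum-zero _ (λ a → sum-zero _ λ b → sum-zero _ λ d → term≡0 a b d) ⟩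
    0ℚ ∎)
  where
  open ≡-Reasoning
  t : Cochain n
  t u v = f u v *ℚ boundary n z u v

  product≡0 : ∀ p q → p ≡ 0ℚ ⊎ q ≡ 0ℚ → p *ℚ q ≡ 0ℚ
  product≡0 _ q (inj₁ refl) = ℚ.*-zeroˡ q
  product≡0 p _ (inj₂ refl) = ℚ.*-zeroʳ p

  t≡0 : ∀ u v → ¬ (u ≡ u₀ × v ≡ v₀) → t u v ≡ 0ℚ
  t≡0 u v other = product≡0 (f u v) (boundary n z u v) (others u v other)

  term≡0 : ∀ a b d → coboundary f a b d *ℚ z a b d ≡ 0ℚ
  term≡0 a b d with z a b d ℚ.≟ 0ℚ
  ... | yes z≡0 = product≡0 (coboundary f a b d) (z a b d) (inj₂ z≡0)
  ... | no  z≢0 = product≡0 (coboundary f a b d) (z a b d) (inj₁ (cocycle a b d z≢0))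

-- Arithmetic modulo n and the subgroup generated by c and −1

least : ∀ {P : ℕ → Set} → (∀ k → Dec (P k)) → ∀ k → P k → ∃ λ d → P d × (∀ j → j < d → ¬ P j)
least {P} P? = <-rec _ λ k rec pk → case k rec pk (ℕ.anyUpTo? P? k)
  where
  case : ∀ k → (∀ {j} → j < k → P j → ∃ λ d → P d × (∀ j → j < d → ¬ P j)) → P k →
         Dec (∃ λ j → j < k × P j) → ∃ λ d → P d × (∀ j → j < d → ¬ P j)
  case k rec pk (yes (j , j<k , pj)) = rec j<k pj
  case k rec pk (no none) = k , pk , λ j j<k pj → none (j , j<k , pj)

module Residues {m : ℕ} (n-prime : Prime (suc m)) where

  n : ℕ
  n = suc m

  infix 5 n∣_
  -- Signed divisibility of integers: a congruence is derived by writing it as an integer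
  -- combination of known ones (`n∣-combine`), an identity left to the ring solver.
  n∣_ : ℤ → Set
  n∣ z = + n ∣ z

  ⟦_⟧ : Fin n → ℤ
  ⟦ x ⟧ = + toℕ x

  n∣-combine : ∀ {a b z} p q → n∣ a → n∣ b → z ≡ p *ℤ a +ℤ q *ℤ b → n∣ z
  n∣-combine p q n∣a n∣b refl = ∣m∣n⇒∣m+n (∣n⇒∣m*n p n∣a) (∣n⇒∣m*n q n∣b)

  n∣-multiple : ∀ {a z} p → n∣ a → z ≡ p *ℤ a → n∣ z
  n∣-multiple p n∣a refl = ∣n⇒∣m*n p n∣a

  -- Euclid's lemma; apart from `2≤n`, primality enters only here.
  n∣-product : ∀ a b → n∣ a *ℤ b → n∣ a ⊎ n∣ b
  n∣-product a b n∣ab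
    with euclidsLemma ∣ a ∣ ∣ b ∣ n-prime (subst (n ∣ℕ_) (ℤ.abs-* a b) (∣⇒∣ᵤ n∣ab))
  ... | inj₁ n∣a = inj₁ (∣ᵤ⇒∣ n∣a)
  ... | inj₂ n∣b = inj₂ (∣ᵤ⇒∣ n∣b)

  n∣-cancel : ∀ a b → ¬ n∣ a → n∣ a *ℤ b → n∣ b
  n∣-cancel a b ¬n∣a n∣ab with n∣-product a b n∣ab
  ... | inj₁ n∣a = contradiction n∣a ¬n∣a
  ... | inj₂ n∣b = n∣b

  small-multiple : ∀ {k} → k < n → n ∣ℕ k → k ≡ 0
  small-multiple {zero}  k<n n∣k = refl
  small-multiple {suc k} k<n n∣k = contradiction (∣⇒≤ n∣k) (ℕ.<⇒≱ k<n)

  -- The distance of two representatives is at most their maximum, hence below `n`, where 0 is the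
  -- only multiple of `n`.
  unique : ∀ {x y : ℕ} → x < n → y < n → n∣ + x -ℤ + y → x ≡ y
  unique {x} {y} x<n y<n n∣x-y = ℤ.+-injective (ℤ.i-j≡0⇒i≡j (+ x) (+ y)
    (ℤ.∣i∣≡0⇒i≡0 (small-multiple ∣x-y∣<n (∣⇒∣ᵤ n∣x-y))))
    where
    ∣x-y∣<n : ∣ + x -ℤ + y ∣ < n
    ∣x-y∣<n = ℕ.≤-<-trans
      (subst (λ z → ∣ z ∣ ≤ x ⊔ y) (sym (ℤ.m-n≡m⊖n x y)) (ℤ.∣m⊝n∣≤m⊔n x y)) (ℕ.⊔-lub x<n y<n)

  Fin-unique : ∀ {x y : Fin n} → n∣ ⟦ x ⟧ -ℤ ⟦ y ⟧ → x ≡ y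
  Fin-unique {x} {y} = toℕ-injective ∘ unique (toℕ<n x) (toℕ<n y)

  n∣⇒≡0 : ∀ {x : Fin n} → n∣ ⟦ x ⟧ → toℕ x ≡ 0
  n∣⇒≡0 {x} n∣x = small-multiple (toℕ<n x) (∣⇒∣ᵤ n∣x)

  residue : ℤ → Fin n
  residue z = fromℕ< (n%ℕd<d z n)

  residue-≡ : ∀ z → n∣ ⟦ residue z ⟧ -ℤ z
  residue-≡ z = divides (-ℤ (z /ℕ n)) (begin
    ⟦ residue z ⟧ -ℤ z       ≡⟨ cong (λ k → + k -ℤ z) (toℕ-fromℕ< (n%ℕd<d z n)) ⟩
    + r -ℤ z                 ≡⟨ cong (λ y → + r -ℤ y) (a≡a%ℕn+[a/ℕn]*n z n) ⟩
    + r -ℤ (+ r +ℤ q *ℤ + n) ≡⟨ simplify (+ r) q (+ n) ⟩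
    (-ℤ q) *ℤ + n            ∎)
    where
    open ≡-Reasoning
    r = z %ℕ n
    q = z /ℕ n
    simplify : ∀ r q n → r -ℤ (r +ℤ q *ℤ n) ≡ (-ℤ q) *ℤ n
    simplify = solveℤ-∀

  2≤n : 2 ≤ n
  2≤n = go m n-prime
    where
    go : ∀ m → Prime (suc m) → 2 ≤ suc m
    go zero    p = contradiction p ¬prime[1]
    go (suc _) _ = s≤s (s≤s z≤n)

  ¬n∣1 : ¬ n∣ + 1
  ¬n∣1 n∣1 with small-multiple 2≤n (∣⇒∣ᵤ n∣1)
  ... | ()

  n∣-refl : ∀ z → n∣ z -ℤ z
  n∣-refl z = divides (+ 0) (ℤ.+-inverseʳ z)

-- Powers of c and its multiplicative order

module Powers {m : ℕ} (n-prime : Prime (suc m)) (c : Fin (suc m)) (c≢0 : toℕ c ≢ 0) where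

  open Residues n-prime

  pow : ℕ → ℤ
  pow k = + (toℕ c ^ k)

  pow-+ : ∀ i j → pow (i + j) ≡ pow i *ℤ pow j
  pow-+ i j = trans (cong +_ (ℕ.^-distribˡ-+-* (toℕ c) i j)) (ℤ.pos-* (toℕ c ^ i) (toℕ c ^ j))

  pow-suc : ∀ i → pow (suc i) ≡ ⟦ c ⟧ *ℤ pow i
  pow-suc i = ℤ.pos-* (toℕ c) (toℕ c ^ i)

  ¬n∣pow : ∀ k → ¬ n∣ pow k
  ¬n∣pow zero    = ¬n∣1
  ¬n∣pow (suc k) n∣c^1+k with n∣-product ⟦ c ⟧ (pow k) (subst n∣_ (pow-suc k) n∣c^1+k)
  ... | inj₁ n∣c   = c≢0 (n∣⇒≡0 n∣c)
  ... | inj₂ n∣c^k = ¬n∣pow k n∣c^k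

  pow-cancel : ∀ {i j} → i ≤ j → n∣ pow i -ℤ pow j → n∣ pow (j ∸ i) -ℤ + 1
  pow-cancel {i} {j} i≤j n∣ = n∣-cancel (pow i) (pow (j ∸ i) -ℤ + 1) (¬n∣pow i)
    (n∣-multiple (-ℤ + 1) n∣ (begin
      pow i *ℤ (pow (j ∸ i) -ℤ + 1)
        ≡⟨ expand (pow i) (pow (j ∸ i)) ⟩
      (-ℤ + 1) *ℤ (pow i -ℤ pow i *ℤ pow (j ∸ i))
        ≡⟨ cong (λ p → (-ℤ + 1) *ℤ (pow i -ℤ p)) pow-j ⟨
      (-ℤ + 1) *ℤ (pow i -ℤ pow j) ∎))
    where
    pow-j : pow j ≡ pow i *ℤ pow (j ∸ i)
    pow-j = trans (cong pow (sym (ℕ.m+[n∸m]≡n i≤j))) (pow-+ i (j ∸ i))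
    open ≡-Reasoning
    expand : ∀ p q → p *ℤ (q -ℤ + 1) ≡ (-ℤ + 1) *ℤ (p -ℤ p *ℤ q)
    expand = solveℤ-∀

  private
    -- Two of the n + 1 exponents from 0 to n give the same residue, and the smaller power can be
    -- cancelled.
    returns : ∃ λ k → 1 ≤ k × n∣ pow k -ℤ + 1
    returns with pigeonhole {m = n} {n = suc n} (ℕ.n<1+n n) (residue ∘ pow ∘ toℕ)
    ... | i , j , i<j , eq = toℕ j ∸ toℕ i , ℕ.m<n⇒0<n∸m i<j , pow-cancel (ℕ.<⇒≤ i<j)
      (n∣-combine (-ℤ + 1) (+ 1) (residue-≡ (pow (toℕ i)))
        (subst (λ r → n∣ ⟦ r ⟧ -ℤ pow (toℕ j)) (sym eq) (residue-≡ (pow (toℕ j))))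
        (simplify (⟦ residue (pow (toℕ i)) ⟧) (pow (toℕ i)) (pow (toℕ j))))
      where
      simplify : ∀ r p q → p -ℤ q ≡ (-ℤ + 1) *ℤ (r -ℤ p) +ℤ + 1 *ℤ (r -ℤ q)
      simplify = solveℤ-∀

  record IsOrder (d : ℕ) : Set where
    field
      1≤ord       : 1 ≤ d
      pow-ord     : n∣ pow d -ℤ + 1
      ord-minimal : ∀ j → 1 ≤ j → j < d → ¬ n∣ pow j -ℤ + 1

  has-order : ∃ IsOrder
  has-order = from-least
    (least (λ k → (1 ℕ.≤? k) ×-dec (+ n ∣? (pow k -ℤ + 1))) (proj₁ returns) (proj₂ returns))
    where
    from-least : (∃ λ d → (1 ≤ d × n∣ pow d -ℤ + 1) × (∀ j → j < d → ¬ (1 ≤ j × n∣ pow j -ℤ + 1))) →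
                 ∃ IsOrder
    from-least (d , (1≤d , pow-d) , minimal) = d , record
      { 1≤ord       = 1≤d
      ; pow-ord     = pow-d
      ; ord-minimal = λ j 1≤j j<d h → minimal j j<d (1≤j , h)
      }

module Order {m : ℕ} (n-prime : Prime (suc m)) (c : Fin (suc m)) (c≢0 : toℕ c ≢ 0)
             (ord : ℕ) (isOrder : Powers.IsOrder n-prime c c≢0 ord) where

  open Residues n-prime
  open Powers n-prime c c≢0
  open IsOrder isOrder

  instance
    ord≢0 : NonZero ord
    ord≢0 = >-nonZero 1≤ord

  pow-multiple : ∀ q → n∣ pow (q * ord) -ℤ + 1
  pow-multiple zero    = n∣-refl (+ 1)
  pow-multiple (suc q) = n∣-combine (pow (q * ord)) (+ 1) pow-ord (pow-multiple q)
    (trans (cong (_-ℤ + 1) (pow-+ ord (q * ord))) (rearrange (pow ord) (pow (q * ord))))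
    where
    rearrange : ∀ p r → p *ℤ r -ℤ + 1 ≡ r *ℤ (p -ℤ + 1) +ℤ + 1 *ℤ (r -ℤ + 1)
    rearrange = solveℤ-∀

  pow-% : ∀ k → n∣ pow k -ℤ pow (k % ord)
  pow-% k = n∣-multiple (pow (k % ord)) (pow-multiple (k / ord)) (begin
    pow k -ℤ pow (k % ord)
      ≡⟨ cong (λ p → p -ℤ pow (k % ord)) pow-k ⟩
    pow (k % ord) *ℤ pow (k / ord * ord) -ℤ pow (k % ord)
      ≡⟨ factor (pow (k % ord)) (pow (k / ord * ord)) ⟩
    pow (k % ord) *ℤ (pow (k / ord * ord) -ℤ + 1) ∎)
    where
    pow-k : pow k ≡ pow (k % ord) *ℤ pow (k / ord * ord)
    pow-k = trans (cong pow (m≡m%n+[m/n]*n k ord)) (pow-+ (k % ord) (k / ord * ord))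
    open ≡-Reasoning
    factor : ∀ r p → r *ℤ p -ℤ r ≡ r *ℤ (p -ℤ + 1)
    factor = solveℤ-∀

  pow-injective : ∀ {i j} → i < ord → j < ord → n∣ pow i -ℤ pow j → i ≡ j
  pow-injective {i} {j} i<d j<d n∣ with ℕ.<-cmp i j
  ... | tri≈ _ i≡j _ = i≡j
  ... | tri< i<j _ _ = contradiction (pow-cancel (ℕ.<⇒≤ i<j) n∣)
          (ord-minimal (j ∸ i) (ℕ.m<n⇒0<n∸m i<j) (ℕ.≤-<-trans (ℕ.m∸n≤m j i) j<d))
  ... | tri> _ _ j<i = contradiction (pow-cancel (ℕ.<⇒≤ j<i) (n∣-multiple (-ℤ + 1) n∣ (flip (pow i) (pow j))))
          (ord-minimal (i ∸ j) (ℕ.m<n⇒0<n∸m j<i) (ℕ.≤-<-trans (ℕ.m∸n≤m i j) i<d))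
    where
    flip : ∀ p q → q -ℤ p ≡ (-ℤ + 1) *ℤ (p -ℤ q)
    flip = solveℤ-∀

  -- The inverse of c, written as a power so that exponents stay natural numbers.
  inv : ℤ
  inv = pow (ord ∸ 1)

  inv-inverse : n∣ ⟦ c ⟧ *ℤ inv -ℤ + 1
  inv-inverse = subst (λ z → n∣ z -ℤ + 1)
    (trans (cong pow (sym (ℕ.m+[n∸m]≡n 1≤ord))) (pow-suc (ord ∸ 1))) pow-ord

  -- Membership in the subgroup ⟨c , −1⟩ of 𝔽ₙ*.
  ±Power : ℤ → Set
  ±Power y = ∃ λ i → n∣ pow i -ℤ y ⊎ n∣ pow i +ℤ y

  -- Bounding the exponent by the order turns the search in `±Power?` into a finite one.
  ±Power-reduce : ∀ y → ±Power y → ∃ λ (i : Fin ord) → n∣ pow (toℕ i) -ℤ y ⊎ n∣ pow (toℕ i) +ℤ y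
  ±Power-reduce y (k , p) = fromℕ< k%d<d ,
    subst (λ r → n∣ pow r -ℤ y ⊎ n∣ pow r +ℤ y) (sym (toℕ-fromℕ< k%d<d))
      (Sum.map (λ h → n∣-combine (-ℤ + 1) (+ 1) (pow-% k) h (shift (pow k) (pow (k % ord)) y))
               (λ h → n∣-combine (-ℤ + 1) (+ 1) (pow-% k) h (shift′ (pow k) (pow (k % ord)) y)) p)
    where
    k%d<d = m%n<n k ord
    shift : ∀ p r y → r -ℤ y ≡ (-ℤ + 1) *ℤ (p -ℤ r) +ℤ + 1 *ℤ (p -ℤ y)
    shift = solveℤ-∀
    shift′ : ∀ p r y → r +ℤ y ≡ (-ℤ + 1) *ℤ (p -ℤ r) +ℤ + 1 *ℤ (p +ℤ y)
    shift′ = solveℤ-∀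

  ±Power? : ∀ y → Dec (±Power y)
  ±Power? y = map′ (λ (i , p) → toℕ i , p) (±Power-reduce y)
    (any? {n = ord} λ i → (+ n ∣? (pow (toℕ i) -ℤ y)) ⊎-dec (+ n ∣? (pow (toℕ i) +ℤ y)))

  ±Power-neg : ∀ x y → n∣ x +ℤ y → ±Power x → ±Power y
  ±Power-neg x y x+y (i , inj₁ h) = i , inj₂ (n∣-combine (+ 1) (+ 1) h x+y (eq (pow i) x y))
    where
    eq : ∀ p x y → p +ℤ y ≡ + 1 *ℤ (p -ℤ x) +ℤ + 1 *ℤ (x +ℤ y)
    eq = solveℤ-∀
  ±Power-neg x y x+y (i , inj₂ h) = i , inj₁ (n∣-combine (+ 1) (-ℤ + 1) h x+y (eq (pow i) x y))
    where
    eq : ∀ p x y → p -ℤ y ≡ + 1 *ℤ (p +ℤ x) +ℤ (-ℤ + 1) *ℤ (x +ℤ y)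
    eq = solveℤ-∀

  ±Power-c* : ∀ y → ±Power y → ±Power (⟦ c ⟧ *ℤ y)
  ±Power-c* y (i , h) = suc i , Sum.map
    (λ h → n∣-multiple ⟦ c ⟧ h (trans (cong (λ p → p -ℤ ⟦ c ⟧ *ℤ y) (pow-suc i)) (eq ⟦ c ⟧ (pow i) y)))
    (λ h → n∣-multiple ⟦ c ⟧ h (trans (cong (λ p → p +ℤ ⟦ c ⟧ *ℤ y) (pow-suc i)) (eq′ ⟦ c ⟧ (pow i) y))) h
    where
    eq : ∀ c p y → c *ℤ p -ℤ c *ℤ y ≡ c *ℤ (p -ℤ y)
    eq = solveℤ-∀
    eq′ : ∀ c p y → c *ℤ p +ℤ c *ℤ y ≡ c *ℤ (p +ℤ y)
    eq′ = solveℤ-∀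

  ±Power-/c : ∀ y → ±Power (⟦ c ⟧ *ℤ y) → ±Power y
  ±Power-/c y (i , h) = i + (ord ∸ 1) , Sum.map
    (λ h → n∣-combine inv y h inv-inverse (trans (cong (λ p → p -ℤ y) (pow-+ i (ord ∸ 1))) (eq ⟦ c ⟧ (pow i) inv y)))
    (λ h → n∣-combine inv (-ℤ y) h inv-inverse (trans (cong (λ p → p +ℤ y) (pow-+ i (ord ∸ 1))) (eq′ ⟦ c ⟧ (pow i) inv y))) h
    where
    eq : ∀ c p v y → p *ℤ v -ℤ y ≡ v *ℤ (p -ℤ c *ℤ y) +ℤ y *ℤ (c *ℤ v -ℤ + 1)
    eq = solveℤ-∀
    eq′ : ∀ c p v y → p *ℤ v +ℤ y ≡ v *ℤ (p +ℤ c *ℤ y) +ℤ (-ℤ y) *ℤ (c *ℤ v -ℤ + 1)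
    eq′ = solveℤ-∀

  -- The case where c and -1 generate all of 𝔽ₙ*

  -1Power : Set
  -1Power = ∃ λ i → n∣ pow i +ℤ + 1

  Full : Set
  Full = ∀ (y : Fin n) → toℕ y ≢ 0 → ±Power ⟦ y ⟧

  -- If -1 is itself a power of c, it absorbs the sign: the negative of `pow i` is congruent to
  -- `pow (k + i)`.
  Full⇒primitive : Full → -1Power → IsPrimitive n c
  Full⇒primitive full (k , n∣-1) y y≢0 with full y y≢0
  ... | i , inj₁ h = i , ∣⇒∣ᵤ h
  ... | i , inj₂ h = k + i , ∣⇒∣ᵤ (n∣-combine (pow i) (-ℤ + 1) n∣-1 h
          (trans (cong (_-ℤ ⟦ y ⟧) (pow-+ k i)) (eq (pow k) (pow i) ⟦ y ⟧)))
    where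
    eq : ∀ p q y → p *ℤ q -ℤ y ≡ q *ℤ (p +ℤ + 1) +ℤ (-ℤ + 1) *ℤ (q +ℤ y)
    eq = solveℤ-∀

  -- Divide by `pow j`: the exponent `j * (ord ∸ 1)` acts as the negative of `j`, since adding `j`
  -- gives a multiple of `ord`.
  -1Power-ratio : ∀ i j → n∣ pow i +ℤ pow j → -1Power
  -1Power-ratio i j h = i + j * (ord ∸ 1) , n∣-combine (pow (j * (ord ∸ 1))) (-ℤ + 1) h one
    (trans (cong (_+ℤ + 1) (pow-+ i _)) (eq (pow i) (pow j) (pow (j * (ord ∸ 1)))))
    where
    eq : ∀ p q r → p *ℤ r +ℤ + 1 ≡ r *ℤ (p +ℤ q) +ℤ (-ℤ + 1) *ℤ (q *ℤ r -ℤ + 1)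
    eq = solveℤ-∀
    one : n∣ pow j *ℤ pow (j * (ord ∸ 1)) -ℤ + 1
    one = subst (λ z → n∣ z -ℤ + 1) (begin
      pow (j * ord)                  ≡⟨ cong (λ d → pow (j * d)) (ℕ.m+[n∸m]≡n 1≤ord) ⟨
      pow (j * suc (ord ∸ 1))        ≡⟨ cong pow (ℕ.*-suc j (ord ∸ 1)) ⟩
      pow (j + j * (ord ∸ 1))        ≡⟨ pow-+ j _ ⟩
      pow j *ℤ pow (j * (ord ∸ 1))   ∎) (pow-multiple j)
      where open ≡-Reasoning

  private
    value : Fin ord ⊎ Fin ord → ℤ
    value (inj₁ i) = pow (toℕ i)
    value (inj₂ i) = -ℤ pow (toℕ i)

    value-injective : ¬ -1Power → ∀ a b → n∣ value a -ℤ value b → a ≡ b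
    value-injective ¬-1 (inj₁ i) (inj₁ j) h = cong inj₁ (toℕ-injective (pow-injective (toℕ<n i) (toℕ<n j) h))
    value-injective ¬-1 (inj₁ i) (inj₂ j) h = contradiction
      (-1Power-ratio (toℕ i) (toℕ j) (subst (λ z → n∣ pow (toℕ i) +ℤ z) (ℤ.neg-involutive (pow (toℕ j))) h)) ¬-1
    value-injective ¬-1 (inj₂ i) (inj₁ j) h = contradiction
      (-1Power-ratio (toℕ i) (toℕ j) (n∣-multiple (-ℤ + 1) h (eq (pow (toℕ i)) (pow (toℕ j))))) ¬-1
      where
      eq : ∀ p q → p +ℤ q ≡ (-ℤ + 1) *ℤ ((-ℤ p) -ℤ q)
      eq = solveℤ-∀
    value-injective ¬-1 (inj₂ i) (inj₂ j) h = cong inj₂ (toℕ-injective (pow-injective (toℕ<n i) (toℕ<n j)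
      (n∣-multiple (-ℤ + 1) h (eq (pow (toℕ i)) (pow (toℕ j))))))
      where
      eq : ∀ p q → p -ℤ q ≡ (-ℤ + 1) *ℤ ((-ℤ p) -ℤ (-ℤ q))
      eq = solveℤ-∀

    ¬n∣value : ∀ a → ¬ n∣ value a
    ¬n∣value (inj₁ i) = ¬n∣pow (toℕ i)
    ¬n∣value (inj₂ i) h = ¬n∣pow (toℕ i) (n∣-multiple (-ℤ + 1) h (eq (pow (toℕ i))))
      where
      eq : ∀ p → p ≡ (-ℤ + 1) *ℤ (-ℤ p)
      eq = solveℤ-∀

    -- Serves to count 𝔽ₙ: 0, the powers of c and their negatives exhaust it under `Full`, and are
    -- pairwise incongruent if -1 is not a power.
    listing : Fin (suc (ord + ord)) → ℤ
    listing zero    = + 0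
    listing (suc k) = value (splitAt ord k)

    listing-injective : ¬ -1Power → ∀ a b → n∣ listing a -ℤ listing b → a ≡ b
    listing-injective ¬-1 zero    zero    h = refl
    listing-injective ¬-1 zero    (suc b) h =
      contradiction (n∣-multiple (-ℤ + 1) h (eq (value (splitAt ord b)))) (¬n∣value (splitAt ord b))
      where
      eq : ∀ p → p ≡ (-ℤ + 1) *ℤ (+ 0 -ℤ p)
      eq = solveℤ-∀
    listing-injective ¬-1 (suc a) zero    h =
      contradiction (subst n∣_ (ℤ.+-identityʳ (value (splitAt ord a))) h) (¬n∣value (splitAt ord a))
    listing-injective ¬-1 (suc a) (suc b) h = cong suc (begin
      a                           ≡⟨ join-splitAt ord ord a ⟨
      join ord ord (splitAt ord a) ≡⟨ cong (join ord ord) (value-injective ¬-1 (splitAt ord a) (splitAt ord b) h) ⟩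
      join ord ord (splitAt ord b) ≡⟨ join-splitAt ord ord b ⟩
      b                           ∎)
      where open ≡-Reasoning

    value-surjective : ∀ y → ±Power y → ∃ λ a → n∣ value a -ℤ y
    value-surjective y p with ±Power-reduce y p
    ... | i , inj₁ h = inj₁ i , h
    value-surjective y p | i , inj₂ h = inj₂ i , n∣-multiple (-ℤ + 1) h (eq (pow (toℕ i)) y)
      where
      eq : ∀ p y → (-ℤ p) -ℤ y ≡ (-ℤ + 1) *ℤ (p +ℤ y)
      eq = solveℤ-∀

    listing-surjective : Full → ∀ (y : Fin n) → ∃ λ a → n∣ listing a -ℤ ⟦ y ⟧
    listing-surjective full zero = zero , n∣-refl (+ 0)
    listing-surjective full y@(suc _) with value-surjective ⟦ y ⟧ (full y λ ())
    ... | a , h = suc (join ord ord a) , subst (λ a → n∣ value a -ℤ ⟦ y ⟧) (sym (splitAt-join ord ord a)) h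

    n∣-trans : ∀ x y z → n∣ x -ℤ y → n∣ x -ℤ z → n∣ y -ℤ z
    n∣-trans x y z h k = n∣-combine (-ℤ + 1) (+ 1) h k (eq x y z)
      where
      eq : ∀ x y z → y -ℤ z ≡ (-ℤ + 1) *ℤ (x -ℤ y) +ℤ + 1 *ℤ (x -ℤ z)
      eq = solveℤ-∀

  -- Injections in both directions between `Fin n` and `Fin (suc (ord + ord))`: the position of a
  -- residue in the listing, and the residue of a listed integer.
  m≡ord+ord : Full → ¬ -1Power → m ≡ ord + ord
  m≡ord+ord full ¬-1 = ℕ.suc-injective (ℕ.≤-antisym
    (injective⇒≤ {f = index} λ {x} {y} eq → Fin-unique
      (n∣-trans (listing (index x)) ⟦ x ⟧ ⟦ y ⟧ (indexed x)
        (subst (λ a → n∣ listing a -ℤ ⟦ y ⟧) (sym eq) (indexed y))))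
    (injective⇒≤ {f = residue ∘ listing} λ {a} {b} eq → listing-injective ¬-1 a b
      (n∣-trans ⟦ residue (listing a) ⟧ (listing a) (listing b) (residue-≡ (listing a))
        (subst (λ r → n∣ ⟦ r ⟧ -ℤ listing b) (sym eq) (residue-≡ (listing b))))))
    where
    index : Fin n → Fin (suc (ord + ord))
    index y = proj₁ (listing-surjective full y)
    indexed : ∀ y → n∣ listing (index y) -ℤ ⟦ y ⟧
    indexed y = proj₂ (listing-surjective full y)

  -- `pow q` is a square root of 1 modulo a prime, and it is not 1 because 0 < q < `ord`.
  even-order⇒-1Power : ∀ q → ord ≡ q + q → -1Power
  even-order⇒-1Power q eq with n∣-product (pow q -ℤ + 1) (pow q +ℤ + 1)
    (subst n∣_ (trans (cong (_-ℤ + 1) (trans (cong pow eq) (pow-+ q q))) (factor (pow q))) pow-ord)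
    where
    factor : ∀ p → p *ℤ p -ℤ + 1 ≡ (p -ℤ + 1) *ℤ (p +ℤ + 1)
    factor = solveℤ-∀
  ... | inj₂ h = q , h
  ... | inj₁ h = contradiction h (ord-minimal q 1≤q (subst (q <_) (sym eq) (ℕ.m<m+n q 1≤q)))
    where
    positive : ∀ q → 1 ≤ q + q → 1 ≤ q
    positive (suc _) _ = s≤s z≤n
    1≤q : 1 ≤ q
    1≤q = positive q (subst (1 ≤_) eq 1≤ord)

  -1Power? : Dec -1Power
  -1Power? = map′ (λ (i , h) → toℕ i , h) reduce (any? {n = ord} λ i → + n ∣? (pow (toℕ i) +ℤ + 1))
    where
    shift : ∀ p r → r +ℤ + 1 ≡ (-ℤ + 1) *ℤ (p -ℤ r) +ℤ + 1 *ℤ (p +ℤ + 1)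
    shift = solveℤ-∀
    reduce : -1Power → ∃ λ (i : Fin ord) → n∣ pow (toℕ i) +ℤ + 1
    reduce (k , h) = fromℕ< (m%n<n k ord) , subst (λ r → n∣ pow r +ℤ + 1) (sym (toℕ-fromℕ< (m%n<n k ord)))
      (n∣-combine (-ℤ + 1) (+ 1) (pow-% k) h (shift (pow k) (pow (k % ord))))

  ¬full : ((n ≡ 1 [mod 4 ] × ¬ IsPrimitive n c)
       ⊎ (n ≡ 3 [mod 4 ] × ¬ IsPrimitive n c × ¬ HasOrder n c ((n ∸ 1) / 2))) → ¬ Full
  ¬full cases full with -1Power?
  ¬full (inj₁ (_ , ¬primitive))     full | yes -1p = ¬primitive (Full⇒primitive full -1p)
  ¬full (inj₂ (_ , ¬primitive , _)) full | yes -1p = ¬primitive (Full⇒primitive full -1p)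
  -- The congruence unfolds to 4 dividing `m`, which is twice `ord`, so the order is even.
  ¬full (inj₁ (divides-ℕ q m≡q*4 , _)) full | no ¬-1p =
    ¬-1p (even-order⇒-1Power q (ℕ.*-cancelˡ-≡ ord (q + q) 2 (begin
      2 * ord        ≡⟨ double ord ⟩
      ord + ord      ≡⟨ m≡ord+ord full ¬-1p ⟨
      m              ≡⟨ m≡q*4 ⟩
      q * 4          ≡⟨ quadruple q ⟩
      2 * (q + q)    ∎)))
    where
    open ≡-Reasoning
    double : ∀ d → 2 * d ≡ d + d
    double = solveℕ-∀
    quadruple : ∀ q → q * 4 ≡ 2 * (q + q)
    quadruple = solveℕ-∀
  ¬full (inj₂ (_ , _ , ¬order))     full | no ¬-1p = ¬order (subst (HasOrder n c) (sym m/2≡ord)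
    (1≤ord , ∣⇒∣ᵤ pow-ord , λ j 1≤j j<d h → ord-minimal j 1≤j j<d (∣ᵤ⇒∣ h)))
    where
    double : ∀ d → d + d ≡ d * 2
    double = solveℕ-∀
    m/2≡ord : m / 2 ≡ ord
    m/2≡ord = trans (cong (_/ 2) (trans (m≡ord+ord full ¬-1p) (double ord))) (m*n/n≡m ord 2)

-- The 2-chains of X

-- A function of the decision, so that linearity and evaluation of case distinctions can be stated
-- as lemmas.
choose : ∀ {P : Set} → Dec P → ℚ → ℚ → ℚ
choose (yes _) p q = p
choose (no _)  p q = q

choose-yes : ∀ {P : Set} (P? : Dec P) {p q} → P → choose P? p q ≡ p
choose-yes (yes _) h = refl
choose-yes (no ¬h) h = contradiction h ¬h

choose-no : ∀ {P : Set} (P? : Dec P) {p q} → ¬ P → choose P? p q ≡ q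
choose-no (yes h) ¬h = contradiction h ¬h
choose-no (no _)  ¬h = refl

linear-choose : ∀ {I P : Set} {L M : (I → ℚ) → ℚ} (P? : Dec P) → Linear L → Linear M →
                Linear (λ w → choose P? (L w) (M w))
linear-choose (yes _) l m = l
linear-choose (no _)  l m = m

when : ∀ {P : Set} → Dec P → ℚ → ℚ
when P? q = choose P? q 0ℚ

when-cong : ∀ {P Q : Set} (P? : Dec P) (Q? : Dec Q) {q} → (P → Q) → (Q → P) → when P? q ≡ when Q? q
when-cong (yes p) Q? f g = sym (choose-yes Q? (f p))
when-cong (no ¬p) Q? f g = sym (choose-no Q? (¬p ∘ g))

linear-when : ∀ {I P : Set} {L : (I → ℚ) → ℚ} (P? : Dec P) → Linear L → Linear (λ w → when P? (L w))
linear-when P? l = linear-choose P? l linear-zero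

-- Pairs index both equations and unknowns; without the equation at `e₀` there is one equation fewer
-- than unknowns, so `kernel` applies.
underdetermined : ∀ m → let n = suc m in
  (E : Fin n × Fin n → (Fin n × Fin n → ℚ) → ℚ) → (∀ e → Linear (E e)) → ∀ e₀ →
  ∃ λ w → (∀ e → e ≢ e₀ → E e w ≡ 0ℚ) × ∃ λ e → w e ≢ 0ℚ
underdetermined m E l e₀@(u₀ , v₀)
  -- `n * n` computes to `suc (m + m * suc m)`; `punchIn` skips the number of `e₀`.
  with kernel (m + m * suc m) (λ k x → E (remQuot (suc m) (punchIn (combine u₀ v₀) k)) (x ∘ uncurry combine))
              (λ k → linear-∘ (uncurry combine) (l (remQuot (suc m) (punchIn (combine u₀ v₀) k))))
... | x , Ex≡0 , j , xj≢0 = x ∘ uncurry combine , solves , remQuot (suc m) j ,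
      subst (λ i → x i ≢ 0ℚ) (sym (combine-remQuot {suc m} (suc m) j)) xj≢0
  where
  solves : ∀ e → e ≢ e₀ → E e (x ∘ uncurry combine) ≡ 0ℚ
  solves (u , v) e≢e₀ = subst (λ e → E e (x ∘ uncurry combine) ≡ 0ℚ)
    (trans (cong (remQuot (suc m)) (punchIn-punchOut p≢)) (remQuot-combine u v)) (Ex≡0 (punchOut p≢))
    where
    p≢ : combine u₀ v₀ ≢ combine u v
    p≢ eq with combine-injective u₀ v₀ u v eq
    ... | refl , refl = e≢e₀ refl

-- Needed because the pairing with a cochain also runs over unsorted pairs: an increasing triple
-- with `u` before `v` forces u < v.
sorted-boundary : ∀ n (z : Chain2 n) → (∀ a b d → z a b d ≢ 0ℚ → a F.< b × b F.< d) →
                  ∀ u v → ¬ u F.< v → boundary n z u v ≡ 0ℚ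
sorted-boundary n z sorted u v u≮v
  rewrite sumFin≡sum n (λ w → z u v w) | sumFin≡sum n (λ w → z u w v) | sumFin≡sum n (λ w → z w u v)
  = cong₂ _+ℚ_ (cong₂ _-ℚ_
      (sum-zero (λ w → z u v w) λ w → vanish u v w (u≮v ∘ proj₁))
      (sum-zero (λ w → z u w v) λ w → vanish u w v (u≮v ∘ uncurry <-trans)))
      (sum-zero (λ w → z w u v) λ w → vanish w u v (u≮v ∘ proj₂))
  where
  vanish : ∀ a b d → ¬ (a F.< b × b F.< d) → z a b d ≡ 0ℚ
  vanish a b d unsorted = decidable-stable (z a b d ℚ.≟ 0ℚ) λ z≢0 → unsorted (sorted a b d z≢0)

-- Faces indexed by pairs, and the linear system for cycles

module Complex {m : ℕ} (n-prime : Prime (suc m)) (c : Fin (suc m)) (c≢1 : toℕ c ≢ 1) where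

  open Residues n-prime

  form : Fin n → Fin n → Fin n → ℤ
  form x y z = ⟦ x ⟧ +ℤ ⟦ y ⟧ +ℤ ⟦ c ⟧ *ℤ ⟦ z ⟧

  form-≡ : ∀ x y z → + (toℕ x + toℕ y + toℕ c * toℕ z) -ℤ + 0 ≡ form x y z
  form-≡ x y z = trans (ℤ.+-identityʳ _) (cong (⟦ x ⟧ +ℤ ⟦ y ⟧ +ℤ_) (ℤ.pos-* (toℕ c) (toℕ z)))

  Lin⇒n∣ : ∀ x y z → Lin n c x y z → n∣ form x y z
  Lin⇒n∣ x y z lin = subst n∣_ (form-≡ x y z) (∣ᵤ⇒∣ lin)

  n∣⇒Lin : ∀ x y z → n∣ form x y z → Lin n c x y z
  n∣⇒Lin x y z h = ∣⇒∣ᵤ (subst n∣_ (sym (form-≡ x y z)) h)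

  Lin? : ∀ x y z → Dec (Lin n c x y z)
  Lin? x y z = map′ (n∣⇒Lin x y z) (Lin⇒n∣ x y z) (+ n ∣? form x y z)

  Lin-swap : ∀ x y z → Lin n c x y z → Lin n c y x z
  Lin-swap x y z lin = n∣⇒Lin y x z (subst n∣_ (cong (_+ℤ ⟦ c ⟧ *ℤ ⟦ z ⟧) (ℤ.+-comm ⟦ x ⟧ ⟦ y ⟧)) (Lin⇒n∣ x y z lin))

  -- Subtracting the equations gives (1 - c)(y - z) ≡ 0. So only one vertex of a face can play the
  -- role of x₂, and each face carries a single unknown.
  Lin-exclusive : ∀ x y z → y ≢ z → Lin n c x y z → ¬ Lin n c x z y
  Lin-exclusive x y z y≢z l l′ with n∣-product (+ 1 -ℤ ⟦ c ⟧) (⟦ y ⟧ -ℤ ⟦ z ⟧)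
    (n∣-combine (+ 1) (-ℤ + 1) (Lin⇒n∣ x y z l) (Lin⇒n∣ x z y l′) (eq ⟦ c ⟧ ⟦ x ⟧ ⟦ y ⟧ ⟦ z ⟧))
    where
    eq : ∀ c x y z → (+ 1 -ℤ c) *ℤ (y -ℤ z) ≡ + 1 *ℤ (x +ℤ y +ℤ c *ℤ z) +ℤ (-ℤ + 1) *ℤ (x +ℤ z +ℤ c *ℤ y)
    eq = solveℤ-∀
  ... | inj₁ n∣1-c = c≢1 (sym (unique 2≤n (toℕ<n c) n∣1-c))
  ... | inj₂ n∣y-z = y≢z (Fin-unique n∣y-z)

  -- w (x , y) with x < y is the coefficient of the face {x, y, -(x + y)/c}.
  chain : (Fin n × Fin n → ℚ) → Chain2 n
  chain w a b d = when ((a <? b) ×-dec (b <? d))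
    (when (Lin? a b d) (w (a , b)) +ℚ (when (Lin? a d b) (w (a , d)) +ℚ when (Lin? b d a) (w (b , d))))

  linear-chain : ∀ a b d → Linear (λ w → chain w a b d)
  linear-chain a b d = linear-when ((a <? b) ×-dec (b <? d)) (linear-+
    (linear-when (Lin? a b d) (linear-eval (a , b)))
    (linear-+ (linear-when (Lin? a d b) (linear-eval (a , d))) (linear-when (Lin? b d a) (linear-eval (b , d)))))

  linear-boundary : ∀ u v → Linear (λ w → boundary n (chain w) u v)
  linear-boundary u v = linear-+
    (linear-- (linear-sumFin n λ k → linear-chain u v k) (linear-sumFin n λ k → linear-chain u k v))
    (linear-sumFin n λ k → linear-chain k u v)

  chain-isChain : ∀ w → IsChainOf n c (chain w)
  chain-isChain w a b d z≢0 with (a <? b) ×-dec (b <? d) | Lin? a b d | Lin? a d b | Lin? b d a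
  ... | no _            | _     | _     | _     = contradiction refl z≢0
  ... | yes (a<b , b<d) | yes l | _     | _     = a<b , b<d , inj₁ l
  ... | yes (a<b , b<d) | no _  | yes l | _     = a<b , b<d , inj₂ (inj₁ l)
  ... | yes (a<b , b<d) | no _  | no _  | yes l = a<b , b<d , inj₂ (inj₂ l)
  ... | yes _           | no _  | no _  | no _  = contradiction refl z≢0

  chain-sorted : ∀ w a b d → chain w a b d ≢ 0ℚ → a F.< b × b F.< d
  chain-sorted w a b d z≢0 with chain-isChain w a b d z≢0
  ... | a<b , b<d , _ = a<b , b<d

  -- Ensures that a nonzero unknown survives in the chain. The place of `z` relative to x < y
  -- decides which summand of `chain` holds it; the other two vanish by `Lin-exclusive`.
  chain-coefficient : ∀ w x y z → x F.< y → z ≢ x → z ≢ y → Lin n c x y z →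
                      ∃ λ a → ∃ λ b → ∃ λ d → chain w a b d ≡ w (x , y)
  chain-coefficient w x y z x<y z≢x z≢y l with <-cmp z x | <-cmp z y
  ... | tri≈ _ z≡x _ | _            = contradiction z≡x z≢x
  ... | _            | tri≈ _ z≡y _ = contradiction z≡y z≢y
  ... | tri< z<x _ _ | _            = z , x , y , (begin
    chain w z x y                       ≡⟨ choose-yes ((z <? x) ×-dec (x <? y)) (z<x , x<y) ⟩
    _                                   ≡⟨ cong₂ _+ℚ_ (choose-no (Lin? z x y) ¬zxy) (cong₂ _+ℚ_
                                             (choose-no (Lin? z y x) ¬zyx) (choose-yes (Lin? x y z) l)) ⟩
    0ℚ +ℚ (0ℚ +ℚ w (x , y))             ≡⟨ trans (ℚ.+-identityˡ _) (ℚ.+-identityˡ _) ⟩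
    w (x , y)                           ∎)
    where
    open ≡-Reasoning
    ¬zxy : ¬ Lin n c z x y
    ¬zxy = Lin-exclusive x y z (z≢y ∘ sym) l ∘ Lin-swap z x y
    ¬zyx : ¬ Lin n c z y x
    ¬zyx = Lin-exclusive y x z (z≢x ∘ sym) (Lin-swap x y z l) ∘ Lin-swap z y x
  ... | tri> _ _ x<z | tri< z<y _ _ = x , z , y , (begin
    chain w x z y                       ≡⟨ choose-yes ((x <? z) ×-dec (z <? y)) (x<z , z<y) ⟩
    _                                   ≡⟨ cong₂ _+ℚ_ (choose-no (Lin? x z y) ¬xzy) (cong₂ _+ℚ_
                                             (choose-yes (Lin? x y z) l) (choose-no (Lin? z y x) ¬zyx)) ⟩
    0ℚ +ℚ (w (x , y) +ℚ 0ℚ)             ≡⟨ trans (ℚ.+-identityˡ _) (ℚ.+-identityʳ _) ⟩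
    w (x , y)                           ∎)
    where
    open ≡-Reasoning
    ¬xzy : ¬ Lin n c x z y
    ¬xzy = Lin-exclusive x y z (z≢y ∘ sym) l
    ¬zyx : ¬ Lin n c z y x
    ¬zyx = Lin-exclusive y x z (z≢x ∘ sym) (Lin-swap x y z l) ∘ Lin-swap z y x
  ... | tri> _ _ x<z | tri> _ _ y<z = x , y , z , (begin
    chain w x y z                       ≡⟨ choose-yes ((x <? y) ×-dec (y <? z)) (x<y , y<z) ⟩
    _                                   ≡⟨ cong₂ _+ℚ_ (choose-yes (Lin? x y z) l) (cong₂ _+ℚ_
                                             (choose-no (Lin? x z y) ¬xzy) (choose-no (Lin? y z x) ¬yzx)) ⟩
    w (x , y) +ℚ (0ℚ +ℚ 0ℚ)             ≡⟨ ℚ.+-identityʳ (w (x , y)) ⟩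
    w (x , y)                           ∎)
    where
    open ≡-Reasoning
    ¬xzy : ¬ Lin n c x z y
    ¬xzy = Lin-exclusive x y z (z≢y ∘ sym) l
    ¬yzx : ¬ Lin n c y z x
    ¬yzx = Lin-exclusive y x z (z≢x ∘ sym) (Lin-swap x y z l)

  -- {x , twin x} is a pair of vertices whose third vertex -(x + twin x)/c is x itself.
  twin : Fin n → Fin n
  twin x = residue (-ℤ (⟦ x ⟧ +ℤ ⟦ c ⟧ *ℤ ⟦ x ⟧))

  twin-unique : ∀ x y → Lin n c x y x → y ≡ twin x
  twin-unique x y l = Fin-unique (n∣-combine (+ 1) (-ℤ + 1) (Lin⇒n∣ x y x l)
    (residue-≡ (-ℤ (⟦ x ⟧ +ℤ ⟦ c ⟧ *ℤ ⟦ x ⟧)))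
    (eq ⟦ x ⟧ ⟦ y ⟧ ⟦ c ⟧ ⟦ twin x ⟧))
    where
    eq : ∀ x y c t → y -ℤ t ≡ + 1 *ℤ (x +ℤ y +ℤ c *ℤ x) +ℤ (-ℤ + 1) *ℤ (t -ℤ (-ℤ (x +ℤ c *ℤ x)))
    eq = solveℤ-∀

  -- One equation per unknown: w is set to 0 off x < y, and the equations of the edges {0 , v}, which
  -- follow from ∂∂ = 0, are replaced by the vanishing of w on the degenerate pairs {v , twin v}.
  equation : Fin n × Fin n → (Fin n × Fin n → ℚ) → ℚ
  equation (zero  , zero)  w = w (zero , zero)
  -- At least one of the two pairs is unsorted, where `w` is 0 by another equation; so the single
  -- sum kills both.
  equation (zero  , suc v) w = w (suc v , twin (suc v)) +ℚ w (twin (suc v) , suc v)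
  equation (suc u , v)     w = choose (suc u <? v) (boundary n (chain w) (suc u) v) (w (suc u , v))

  linear-equation : ∀ e → Linear (equation e)
  linear-equation (zero  , zero)  = linear-eval _
  linear-equation (zero  , suc v) = linear-+ (linear-eval _) (linear-eval _)
  linear-equation (suc u , v)     = linear-choose (suc u <? v) (linear-boundary (suc u) v) (linear-eval _)

  -- By boundary-redundant, f makes the equation of the edge (u₀ , v₀) redundant. Without it there
  -- are fewer equations than unknowns.
  module _ (f : Cochain n) (f-zero : ∀ v → f zero v ≡ 0ℚ)
           (f-closed : ∀ a b d → IsTwoFace n c a b d → coboundary f a b d ≡ 0ℚ)
           (u₀ v₀ : Fin n) (u₀<v₀ : u₀ F.< v₀) (f≢0 : f u₀ v₀ ≢ 0ℚ)
           (third : Fin n → Fin n → Fin n) (third-Lin : ∀ x y → Lin n c x y (third x y)) where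

    module Solution (w : Fin n × Fin n → ℚ) (w-solves : ∀ e → e ≢ (u₀ , v₀) → equation e w ≡ 0ℚ) where

      z : Chain2 n
      z = chain w

      -- The omitted equation is not in row 0, where `f` vanishes.
      u₀≢0 : zero ≢ u₀
      u₀≢0 refl = f≢0 (f-zero v₀)

      w-upper : ∀ u v → ¬ u F.< v → w (u , v) ≡ 0ℚ
      w-upper zero    zero    _   = w-solves (zero , zero) (u₀≢0 ∘ cong proj₁)
      w-upper zero    (suc v) u≮v = contradiction (s≤s z≤n) u≮v
      -- The omitted equation belongs to a sorted pair, so every equation for an unsorted pair is
      -- available.
      w-upper (suc u) v       u≮v = trans (sym (choose-no (suc u <? v) u≮v))
                                          (w-solves (suc u , v) λ { refl → u≮v u₀<v₀ })

      w-twins : ∀ x → x ≢ zero → w (x , twin x) ≡ 0ℚ × w (twin x , x) ≡ 0ℚ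
      w-twins zero    x≢0 = contradiction refl x≢0
      w-twins x@(suc _) _ with w-solves (zero , x) (u₀≢0 ∘ cong proj₁) | x <? twin x
      ... | eq | no x≮t  = w-upper x (twin x) x≮t ,
                           trans (sym (ℚ.+-identityˡ _))
                             (trans (cong (_+ℚ w (twin x , x)) (sym (w-upper x (twin x) x≮t))) eq)
      ... | eq | yes x<t = trans (sym (ℚ.+-identityʳ _)) (trans (cong (w (x , twin x) +ℚ_) (sym t-x)) eq) , t-x
        where
        t-x = w-upper (twin x) x (<-asym x<t)

      unsorted : ∀ u v → ¬ u F.< v → boundary n z u v ≡ 0ℚ
      unsorted = sorted-boundary n z (chain-sorted w)

      boundary-suc : ∀ u v → ¬ (suc u ≡ u₀ × v ≡ v₀) → boundary n z (suc u) v ≡ 0ℚ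
      boundary-suc u v other = by-order (suc u <? v)
        where
        by-order : Dec (suc u F.< v) → boundary n z (suc u) v ≡ 0ℚ
        by-order (no u≮v)  = unsorted (suc u) v u≮v
        by-order (yes u<v) = trans (sym (choose-yes (suc u <? v) u<v))
                                   (w-solves (suc u , v) λ { refl → other (refl , refl) })

      -- The boundary on the edges at 0 is still unknown at this point, but `f` is 0 there; this is
      -- what the normalisation of the cocycle is for.
      boundary-e₀ : boundary n z u₀ v₀ ≡ 0ℚ
      boundary-e₀ = boundary-redundant n f z (λ a b d → f-closed a b d ∘ chain-isChain w a b d) u₀ v₀ f≢0 others
        where
        others : ∀ u v → ¬ (u ≡ u₀ × v ≡ v₀) → f u v ≡ 0ℚ ⊎ boundary n z u v ≡ 0ℚ
        others zero    v _     = inj₁ (f-zero v)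
        others (suc u) v other = inj₂ (boundary-suc u v other)

      boundary-off-0 : ∀ u v → boundary n z (suc u) v ≡ 0ℚ
      boundary-off-0 u v = by-edge ((suc u ≟F u₀) ×-dec (v ≟F v₀))
        where
        by-edge : Dec (suc u ≡ u₀ × v ≡ v₀) → boundary n z (suc u) v ≡ 0ℚ
        by-edge (yes (u≡u₀ , v≡v₀)) =
          subst (λ (u , v) → boundary n z u v ≡ 0ℚ) (sym (cong₂ _,_ u≡u₀ v≡v₀)) boundary-e₀
        by-edge (no other)          = boundary-suc u v other

      -- The relation ∂∂ = 0 at the vertex `suc v`: `g` is the coboundary of its indicator `δ`, and
      -- in row 0 it is nonzero only on the edge in question.
      boundary-0 : ∀ v → boundary n z zero (suc v) ≡ 0ℚ
      boundary-0 v = boundary-redundant n g z (λ a b d _ → closed (δ a) (δ b) (δ d)) zero (suc v) g≢0 others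
        where
        δ : Fin n → ℚ
        δ x = when (x ≟F suc v) 1ℚ
        g : Cochain n
        g a b = δ b -ℚ δ a
        closed : ∀ p q r → (q -ℚ p) -ℚ (r -ℚ p) +ℚ (r -ℚ q) ≡ 0ℚ
        closed = solve-∀ ℚ-ring
        g≢0 : g zero (suc v) ≢ 0ℚ
        g≢0 eq with trans (sym (cong (_-ℚ 0ℚ) (choose-yes (suc v ≟F suc v) {1ℚ} refl))) eq
        ... | ()
        others : ∀ u v′ → ¬ (u ≡ zero × v′ ≡ suc v) → g u v′ ≡ 0ℚ ⊎ boundary n z u v′ ≡ 0ℚ
        others zero    v′ other = inj₁ (cong (_-ℚ 0ℚ) (choose-no (v′ ≟F suc v) λ eq → other (refl , eq)))
        others (suc u) v′ _     = inj₂ (boundary-off-0 u v′)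

      cycle : ∀ u v → u F.< v → boundary n z u v ≡ 0ℚ
      cycle zero    (suc v) _ = boundary-0 v
      cycle (suc u) v       _ = boundary-off-0 u v

      nonzero : ∀ x y → w (x , y) ≢ 0ℚ → ∃ λ a → ∃ λ b → ∃ λ d → z a b d ≢ 0ℚ
      nonzero x y w≢0 = let a , b , d , eq = chain-coefficient w x y t x<y t≢x t≢y (third-Lin x y) in
        a , b , d , λ z≡0 → w≢0 (trans (sym eq) z≡0)
        where
        t = third x y
        x<y : x F.< y
        x<y = decidable-stable (x <? y) λ x≮y → w≢0 (w-upper x y x≮y)
        y≢0 : y ≢ zero
        y≢0 refl with x<y
        ... | ()
        -- `w-twins` leaves out the vertex 0, but 0 is its own twin, which x < y excludes.
        twin-of-0 : ∀ {y} → Lin n c zero y zero → y ≡ zero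
        twin-of-0 {y} l = Fin-unique (n∣-multiple (+ 1) (Lin⇒n∣ zero y zero l) (eq ⟦ y ⟧ ⟦ c ⟧))
          where
          eq : ∀ y c → y -ℤ + 0 ≡ + 1 *ℤ (+ 0 +ℤ y +ℤ c *ℤ + 0)
          eq = solveℤ-∀
        t≢x : t ≢ x
        t≢x t≡x = w≢0 (subst (λ v → w (x , v) ≡ 0ℚ) (sym (twin-unique x y l)) (proj₁ (w-twins x x≢0)))
          where
          l : Lin n c x y x
          l = subst (Lin n c x y) t≡x (third-Lin x y)
          x≢0 : x ≢ zero
          x≢0 x≡0 = y≢0 (twin-of-0 (subst (λ x → Lin n c x y x) x≡0 l))
        t≢y : t ≢ y
        t≢y t≡y = w≢0 (subst (λ v → w (v , y) ≡ 0ℚ) (sym (twin-unique y x l)) (proj₂ (w-twins y y≢0)))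
          where
          l : Lin n c y x y
          l = Lin-swap x y y (subst (Lin n c x y) t≡y (third-Lin x y))

    cycle-from-cocycle : H2Nonzero n c
    cycle-from-cocycle = from-solution (underdetermined m equation linear-equation (u₀ , v₀))
      where
      from-solution : (∃ λ w → (∀ e → e ≢ (u₀ , v₀) → equation e w ≡ 0ℚ) × ∃ λ e → w e ≢ 0ℚ) → H2Nonzero n c
      from-solution (w , w-solves , (x , y) , w≢0) = chain w , chain-isChain w , cycle , nonzero x y w≢0
        where open Solution w w-solves

-- The cocycle of the subgroup generated by c and -1, and the conclusion

module Cocycle {m : ℕ} (n-prime : Prime (suc m)) (c : Fin (suc m)) (c≢0 : toℕ c ≢ 0) (c≢1 : toℕ c ≢ 1)
               (ord : ℕ) (isOrder : Powers.IsOrder n-prime c c≢0 ord) where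

  open Residues n-prime
  open Complex n-prime c c≢1
  open Order n-prime c c≢0 ord isOrder

  indicator : Fin n → ℚ
  indicator x = when (±Power? ⟦ x ⟧) 1ℚ

  -- The coboundary of the indicator of ⟨c , −1⟩, corrected to 0 on the edges at 0.
  cocycle : Cochain n
  cocycle zero    b = 0ℚ
  cocycle (suc a) b = indicator b -ℚ indicator (suc a)

  indicator-cong : ∀ x y → (±Power ⟦ x ⟧ → ±Power ⟦ y ⟧) → (±Power ⟦ y ⟧ → ±Power ⟦ x ⟧) →
                   indicator x -ℚ indicator y ≡ 0ℚ
  indicator-cong x y f g = trans (cong (_-ℚ indicator y) (when-cong (±Power? ⟦ x ⟧) (±Power? ⟦ y ⟧) f g))
                                 (ℚ.+-inverseʳ (indicator y))

  indicator-c : ∀ x y → n∣ ⟦ x ⟧ +ℤ ⟦ c ⟧ *ℤ ⟦ y ⟧ →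
                (±Power ⟦ x ⟧ → ±Power ⟦ y ⟧) × (±Power ⟦ y ⟧ → ±Power ⟦ x ⟧)
  indicator-c x y h =
    ±Power-/c ⟦ y ⟧ ∘ ±Power-neg ⟦ x ⟧ (⟦ c ⟧ *ℤ ⟦ y ⟧) h ,
    ±Power-neg (⟦ c ⟧ *ℤ ⟦ y ⟧) ⟦ x ⟧ (subst n∣_ (ℤ.+-comm ⟦ x ⟧ (⟦ c ⟧ *ℤ ⟦ y ⟧)) h) ∘ ±Power-c* ⟦ y ⟧

  -- Off 0 this is the coboundary of a coboundary. On a face with vertices 0, b, d one of b + cd, d
  -- + cb, b + d is 0 modulo n, according to which vertex is x₂, so the subgroup contains both b and
  -- d or neither.
  cocycle-closed : ∀ a b d → IsTwoFace n c a b d → coboundary cocycle a b d ≡ 0ℚ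
  cocycle-closed (suc a) (suc b) d _ = closed (indicator (suc a)) (indicator (suc b)) (indicator d)
    where
    closed : ∀ p q r → (q -ℚ p) -ℚ (r -ℚ p) +ℚ (r -ℚ q) ≡ 0ℚ
    closed = solve-∀ ℚ-ring
  cocycle-closed zero b@(suc _) d (_ , _ , face) = trans (ℚ.+-identityˡ (indicator d -ℚ indicator b)) (by-face face)
    where
    eq : ∀ x c → x +ℤ c *ℤ + 0 ≡ x
    eq = solveℤ-∀
    by-face : Lin n c zero b d ⊎ Lin n c zero d b ⊎ Lin n c b d zero → indicator d -ℚ indicator b ≡ 0ℚ
    by-face (inj₁ l) with indicator-c b d (Lin⇒n∣ zero b d l)
    ... | b⇒d , d⇒b = indicator-cong d b d⇒b b⇒d
    by-face (inj₂ (inj₁ l)) = uncurry (indicator-cong d b) (indicator-c d b (Lin⇒n∣ zero d b l))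
    by-face (inj₂ (inj₂ l)) = indicator-cong d b
      (±Power-neg ⟦ d ⟧ ⟦ b ⟧ (subst n∣_ (ℤ.+-comm ⟦ b ⟧ ⟦ d ⟧) b+d)) (±Power-neg ⟦ b ⟧ ⟦ d ⟧ b+d)
      where
      b+d : n∣ ⟦ b ⟧ +ℤ ⟦ d ⟧
      b+d = subst n∣_ (eq (⟦ b ⟧ +ℤ ⟦ d ⟧) ⟦ c ⟧) (Lin⇒n∣ b d zero l)

  third : Fin n → Fin n → Fin n
  third x y = residue (-ℤ (inv *ℤ (⟦ x ⟧ +ℤ ⟦ y ⟧)))

  third-Lin : ∀ x y → Lin n c x y (third x y)
  third-Lin x y = n∣⇒Lin x y (third x y) (n∣-combine ⟦ c ⟧ (-ℤ (⟦ x ⟧ +ℤ ⟦ y ⟧))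
    (residue-≡ (-ℤ (inv *ℤ (⟦ x ⟧ +ℤ ⟦ y ⟧)))) inv-inverse (eq ⟦ x ⟧ ⟦ y ⟧ ⟦ c ⟧ inv ⟦ third x y ⟧))
    where
    eq : ∀ x y c v t → x +ℤ y +ℤ c *ℤ t ≡ c *ℤ (t -ℤ (-ℤ (v *ℤ (x +ℤ y)))) +ℤ (-ℤ (x +ℤ y)) *ℤ (c *ℤ v -ℤ + 1)
    eq = solveℤ-∀

  one : Fin n
  one = residue (+ 1)

  one-±Power : ±Power ⟦ one ⟧
  one-±Power = 0 , inj₁ (n∣-multiple (-ℤ + 1) (residue-≡ (+ 1)) (eq ⟦ one ⟧))
    where
    eq : ∀ x → + 1 -ℤ x ≡ (-ℤ + 1) *ℤ (x -ℤ + 1)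
    eq = solveℤ-∀

  one≢0 : one ≢ zero
  one≢0 eq = ¬n∣1 (n∣-multiple (-ℤ + 1) (subst (λ x → n∣ ⟦ x ⟧ -ℤ + 1) eq (residue-≡ (+ 1))) refl)

  indicator-one : indicator one ≡ 1ℚ
  indicator-one = choose-yes (±Power? ⟦ one ⟧) one-±Power

  -- The indicator separates 1 from `y`, so the cocycle is nonzero on the edge between them; the
  -- comparison only orients that edge.
  ¬full⇒cycle : ∀ y → y ≢ zero → ¬ ±Power ⟦ y ⟧ → H2Nonzero n c
  ¬full⇒cycle y y≢0 ¬±y with <-cmp y one
  ... | tri≈ _ refl _ = contradiction one-±Power ¬±y
  ... | tri< y<1 _ _  =
    cycle-from-cocycle cocycle (λ _ → refl) cocycle-closed y one y<1 (jump y y≢0 refl) third third-Lin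
    where
    -- A variable `x` equal to the smaller endpoint can be split, so that `cocycle` computes and its
    -- zero row is excluded.
    jump : ∀ x → x ≢ zero → x ≡ y → cocycle x one ≢ 0ℚ
    jump zero    x≢0 _    = contradiction refl x≢0
    jump (suc x) _   refl eq with trans (sym (cong₂ _-ℚ_ indicator-one (choose-no (±Power? ⟦ y ⟧) ¬±y))) eq
    ... | ()
  ... | tri> _ _ 1<y  =
    cycle-from-cocycle cocycle (λ _ → refl) cocycle-closed one y 1<y (jump one one≢0 refl) third third-Lin
    where
    jump : ∀ x → x ≢ zero → x ≡ one → cocycle x y ≢ 0ℚ
    jump zero    x≢0 _   = contradiction refl x≢0
    jump (suc x) _   x≡1 eq with trans (sym (cong₂ _-ℚ_ (choose-no (±Power? ⟦ y ⟧) ¬±y)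
                                                     (trans (cong indicator x≡1) indicator-one))) eq
    ... | ()

  cases⇒cycle : ((n ≡ 1 [mod 4 ] × ¬ IsPrimitive n c)
       ⊎ (n ≡ 3 [mod 4 ] × ¬ IsPrimitive n c × ¬ HasOrder n c ((n ∸ 1) / 2))) → H2Nonzero n c
  cases⇒cycle cases = conclude (any? λ y → ¬? (y ≟F zero) ×-dec ¬? (±Power? ⟦ y ⟧))
    where
    conclude : Dec (∃ λ y → y ≢ zero × ¬ ±Power ⟦ y ⟧) → H2Nonzero n c
    conclude (yes (y , y≢0 , ¬±y)) = ¬full⇒cycle y y≢0 ¬±y
    conclude (no none) = contradiction
      (λ y y≢0 → decidable-stable (±Power? ⟦ y ⟧) λ ¬±y → none (y , y≢0 ∘ cong toℕ , ¬±y))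
      (¬full cases)

theorem2 : (n : ℕ) → Prime n → (c : Fin n)
    → toℕ c ≢ 0 → toℕ c ≢ 1 → ¬ (toℕ c + 1 ≡ 0 [mod n ]) → ¬ (toℕ c + 2 ≡ 0 [mod n ])
    → ((n ≡ 1 [mod 4 ] × ¬ IsPrimitive n c)
    ⊎ (n ≡ 3 [mod 4 ] × ¬ IsPrimitive n c × ¬ HasOrder n c ((n ∸ 1) / 2)))
    → H2Nonzero n c
theorem2 (suc m) n-prime c c≢0 c≢1 _ _ cases = from-order (Powers.has-order n-prime c c≢0)
  where
  from-order : ∃ (Powers.IsOrder n-prime c c≢0) → H2Nonzero (suc m) c
  from-order (ord , isOrder) = Cocycle.cases⇒cycle n-prime c c≢0 c≢1 ord isOrder cases
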